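{- Let $\mathbf{SH}$ be any of the ten Smiley-Hanson systems $\mathbf{OK}$, $\mathbf{OM}$, $\mathbf{OS4}$, $\mathbf{OB}$, $\mathbf{OS5}$, $\mathbf{OK}^{+}$, $\mathbf{OM}^{+}$, $\mathbf{OS4}^{+}$, $\mathbf{OB}^{+}$, $\mathbf{OS5}^{+}$ of monadic deontic logic. Then for every formula $\phi$ of $\mathbf{L_1}$, $\vdash_{\mathbf{SH}} B^O(\phi)$ implies $\vdash_{\mathbf{L_1}} \phi$.
   Context: The system $\mathbf{L_1}$ (Leśniewski's propositional ontology): fix a countably infinite set of name variables. The atomic formulas are exactly the expressions $\epsilon ab$ with $a,b$ name variables (possibly equal); formulas are built from atomic formulas by $\vee$ and $\neg$, the other connectives being the usual classical abbreviations. $\mathbf{L_1}$ is a Hilbert-style system of classical propositional logic (with modus ponens) over these formulas with the additional axiom schemata, for all name variables $a,b,c$: (Ax1) $\epsilon ab \supset \epsilon aa$; (Ax2) $(\epsilon ab \wedge \epsilon bc) \supset \epsilon ac$; (Ax3) $(\epsilon ab \wedge \epsilon bc) \supset \epsilon ba$. Smiley-Hanson systems: formulas are those of propositional modal logic, built from propositional variables with $\top,\bot,\neg,\wedge,\vee,\rightarrow,\leftrightarrow$ and unary operators $O$ (obligation) and $P$ (permission). All systems have the rules modus ponens and $O$-necessitation (from $\vdash A$ infer $\vdash OA$). Axiom schemata: (A0) all classical propositional tautologies; (A1) $PA \leftrightarrow \neg O\neg A$; (A2) $O(A\rightarrow B)\rightarrow(OA\rightarrow OB)$; (A3) $OA\rightarrow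 PA$; (A4) $OA\rightarrow OOA$; (A5) $POA\rightarrow OA$; (A6) $O(OA\rightarrow A)$; (A7) $O(POA\rightarrow A)$. The systems are: $\mathbf{OK}$ = A0--A2; $\mathbf{OM}$ = A0--A2, A6; $\mathbf{OS4}$ = A0--A2, A4, A6; $\mathbf{OB}$ = A0--A2, A6, A7; $\mathbf{OS5}$ = A0--A2, A4, A5; and for each of these five systems $X$, $X^{+}$ is $X$ together with A3. The translation $B^O$: to each name variable $a$ corresponds a propositional variable $p_a$, with distinct name variables corresponding to distinct propositional variables. Then $B^O(\phi\vee\psi)=B^O(\phi)\vee B^O(\psi)$, $B^O(\neg\phi)=\neg B^O(\phi)$, and $B^O(\epsilon ab)= p_a\wedge O(p_a\supset p_b)\wedge\bigl(p_b\supset O(p_b\supset p_a)\bigr)$, where $\supset$ denotes (material) implication. -}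

module Defs where

open import Data.Bool using (Bool; true; false; not; _∧_; _∨_; _xor_)
open import Data.List using (List; []; _∷_)
open import Data.List.Membership.Propositional using (_∈_)
open import Data.Nat using (ℕ)
open import Relation.Binary.PropositionalEquality using (_≡_)

NameVar : Set
NameVar = ℕ

PropVar : Set
PropVar = ℕ

module L₁ where

  infix  9 ¬̇_
  infixr 7 _∧̇_
  infixr 6 _∨̇_
  infixr 5 _⊃_
  infix  3 ⊢_

  data Formula : Set where
    ε    : NameVar → NameVar → Formula
    _∨̇_  : Formula → Formula → Formula
    ¬̇_   : Formula → Formula

  _∧̇_ : Formula → Formula → Formula
  φ ∧̇ ψ = ¬̇ (¬̇ φ ∨̇ ¬̇ ψ)

  _⊃_ : Formula → Formula → Formula
  φ ⊃ ψ = ¬̇ φ ∨̇ ψ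

  eval : (NameVar → NameVar → Bool) → Formula → Bool
  eval v (ε a b)  = v a b
  eval v (φ ∨̇ ψ)  = eval v φ ∨ eval v ψ
  eval v (¬̇ φ)    = not (eval v φ)

  Tautology : Formula → Set
  Tautology φ = ∀ v → eval v φ ≡ true

  -- Classical propositional logic is axiomatised by taking every tautology
  -- as an axiom, with modus ponens as the only rule.
  data ⊢_ : Formula → Set where
    taut : ∀ {φ} → Tautology φ → ⊢ φ
    ax1  : ∀ a b   → ⊢ ε a b ⊃ ε a a
    ax2  : ∀ a b c → ⊢ (ε a b ∧̇ ε b c) ⊃ ε a c
    ax3  : ∀ a b c → ⊢ (ε a b ∧̇ ε b c) ⊃ ε b a
    mp   : ∀ {φ ψ} → ⊢ φ ⊃ ψ → ⊢ φ → ⊢ ψ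

module SH where

  infix  9 ¬̇_
  infixr 7 _∧̇_
  infixr 6 _∨̇_
  infixr 5 _→̇_
  infix  4 _↔̇_
  infix  3 _⊢_

  data Formula : Set where
    var                    : PropVar → Formula
    ⊤̇ ⊥̇                    : Formula
    ¬̇_                     : Formula → Formula
    _∧̇_ _∨̇_ _→̇_ _↔̇_        : Formula → Formula → Formula
    O P                    : Formula → Formula

  -- The formulas O A and P A count as atoms here: v assigns truth values to
  -- them independently of the value of A.  (The values of v at formulas of
  -- any other shape, apart from variables, are never consulted.)
  eval : (Formula → Bool) → Formula → Bool
  eval v (var p)   = v (var p)
  eval v ⊤̇         = true
  eval v ⊥̇         = false
  eval v (¬̇ A)     = not (eval v A)
  eval v (A ∧̇ B)   = eval v A ∧ eval v B
  eval v (A ∨̇ B)   = eval v A ∨ eval v B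
  eval v (A →̇ B)   = not (eval v A) ∨ eval v B
  eval v (A ↔̇ B)   = not (eval v A xor eval v B)
  eval v (O A)     = v (O A)
  eval v (P A)     = v (P A)

  Tautology : Formula → Set
  Tautology A = ∀ v → eval v A ≡ true

  data Schema : Set where
    A0 A1 A2 A3 A4 A5 A6 A7 : Schema

  data Instance : Schema → Formula → Set where
    a0 : ∀ {A} → Tautology A → Instance A0 A
    a1 : ∀ A   → Instance A1 (P A ↔̇ ¬̇ O (¬̇ A))
    a2 : ∀ A B → Instance A2 (O (A →̇ B) →̇ (O A →̇ O B))
    a3 : ∀ A   → Instance A3 (O A →̇ P A)
    a4 : ∀ A   → Instance A4 (O A →̇ O (O A))
    a5 : ∀ A   → Instance A5 (P (O A) →̇ O A)
    a6 : ∀ A   → Instance A6 (O (O A →̇ A))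
    a7 : ∀ A   → Instance A7 (O (P (O A) →̇ A))

  data System : Set where
    OK  OM  OS4  OB  OS5  : System
    OK⁺ OM⁺ OS4⁺ OB⁺ OS5⁺ : System

  schemata : System → List Schema
  schemata OK   = A0 ∷ A1 ∷ A2 ∷ []
  schemata OM   = A0 ∷ A1 ∷ A2 ∷ A6 ∷ []
  schemata OS4  = A0 ∷ A1 ∷ A2 ∷ A4 ∷ A6 ∷ []
  schemata OB   = A0 ∷ A1 ∷ A2 ∷ A6 ∷ A7 ∷ []
  schemata OS5  = A0 ∷ A1 ∷ A2 ∷ A4 ∷ A5 ∷ []
  schemata OK⁺  = A3 ∷ schemata OK
  schemata OM⁺  = A3 ∷ schemata OM
  schemata OS4⁺ = A3 ∷ schemata OS4
  schemata OB⁺  = A3 ∷ schemata OB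
  schemata OS5⁺ = A3 ∷ schemata OS5

  data _⊢_ (S : System) : Formula → Set where
    axiom : ∀ {σ A} → σ ∈ schemata S → Instance σ A → S ⊢ A
    mp    : ∀ {A B} → S ⊢ A →̇ B → S ⊢ A → S ⊢ B
    nec   : ∀ {A} → S ⊢ A → S ⊢ O A

-- The first argument is the assignment a ↦ p_a.
Bᴼ : (NameVar → PropVar) → L₁.Formula → SH.Formula
Bᴼ p (L₁.ε a b)  = pₐ ∧̇ O (pₐ →̇ p_b) ∧̇ (p_b →̇ O (p_b →̇ pₐ))
  where
  open SH
  pₐ  = var (p a)
  p_b = var (p b)
Bᴼ p (φ L₁.∨̇ ψ)  = Bᴼ p φ SH.∨̇ Bᴼ p ψ
Bᴼ p (L₁.¬̇ φ)    = SH.¬̇ Bᴼ p φ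

{-# OPTIONS --safe #-}

-- All ten systems are sound for Kripke models in which every world sees
-- exactly the worlds of one fixed nonempty cluster, the actual world not
-- necessarily among them.  Given an L₁-model v on the finitely many names of φ,
-- let p_a hold at the cluster world c iff ε c a, and at the actual world iff
-- ε a a.  Then Bᴼ (ε a b) holds at the actual world iff ε a b does: if ε a a,
-- instantiating O (p_a ⊃ p_b) at the cluster world a gives ε a b.  So φ is true
-- in every L₁-model on its names, i.e. it is a tautological consequence of
-- finitely many axioms of L₁.
module Submission where

open import Defs
open import Data.Bool using (Bool; true; false; not; _∧_; _∨_; _xor_; T)
open import Data.Bool.ListAction using (all; any)
open import Data.Bool.Properties using (T-∧; T-≡; T?; xor-same)
open import Data.List using (List; []; _∷_; _++_; map; concatMap; cartesianProduct)
open import Data.List.Membership.Propositional using (_∈_; lose; find)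
open import Data.List.Membership.Propositional.Properties
  using (∈-++⁺ˡ; ∈-++⁺ʳ; ∈-cartesianProduct⁺)
open import Data.List.Relation.Unary.All as All using (All; []; _∷_)
open import Data.List.Relation.Unary.All.Properties using (all⁺; all⁻; map⁺; map⁻; concat⁺; concat⁻)
open import Data.List.Relation.Unary.Any using (here; there)
open import Data.List.Relation.Unary.Any.Properties using (any⁺; any⁻)
open import Data.Nat using (_≡ᵇ_)
open import Data.Nat.Properties using (≡ᵇ⇒≡; ≡⇒≡ᵇ)
open import Data.Product using (_×_; _,_; proj₁; proj₂)
open import Data.Unit using (tt)
open import Function using (_∘_)
open import Function.Bundles using (_⇔_; mk⇔; module Equivalence)
open import Function.Definitions using (Injective)
open import Relation.Binary.PropositionalEquality using (_≡_; refl; cong; cong₂; subst)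
open import Relation.Nullary using (¬_; yes; no; contradiction)

open Equivalence using (to; from)

T-⇒ : ∀ {x y} → T (not x ∨ y) ⇔ (T x → T y)
T-⇒ {true}  = mk⇔ (λ y _ → y) (λ f → f tt)
T-⇒ {false} = mk⇔ (λ _ ()) (λ _ → tt)

T-not : ∀ {x} → T (not x) ⇔ (¬ T x)
T-not {true}  = mk⇔ (λ ()) (λ f → f tt)
T-not {false} = mk⇔ (λ _ ()) (λ _ → tt)

T-cong : ∀ {x y} → T x ⇔ T y → x ≡ y
T-cong {true}  {true}  _ = refl
T-cong {true}  {false} e with () ← to e tt
T-cong {false} {true}  e with () ← from e tt
T-cong {false} {false} _ = refl

module ClusterModel {W : Set} (c : W) (cs : List W) (V : PropVar → W → Bool) where

  open SH

  cluster : List W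
  cluster = c ∷ cs

  ⟦_⟧ : Formula → W → Bool
  ⟦ var q ⟧  w = V q w
  ⟦ ⊤̇ ⟧      w = true
  ⟦ ⊥̇ ⟧      w = false
  ⟦ ¬̇ A ⟧    w = not (⟦ A ⟧ w)
  ⟦ A ∧̇ B ⟧  w = ⟦ A ⟧ w ∧ ⟦ B ⟧ w
  ⟦ A ∨̇ B ⟧  w = ⟦ A ⟧ w ∨ ⟦ B ⟧ w
  ⟦ A →̇ B ⟧  w = not (⟦ A ⟧ w) ∨ ⟦ B ⟧ w
  ⟦ A ↔̇ B ⟧  w = not (⟦ A ⟧ w xor ⟦ B ⟧ w)
  ⟦ O A ⟧    w = all ⟦ A ⟧ cluster
  ⟦ P A ⟧    w = not (all (λ u → not (⟦ A ⟧ u)) cluster)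

  -- At each world, `⟦_⟧` is itself a valuation in the sense of `eval`, which treats `O A` and `P A`
  -- as atoms. This is what validates A0.
  eval-⟦⟧ : ∀ A w → eval (λ B → ⟦ B ⟧ w) A ≡ ⟦ A ⟧ w
  eval-⟦⟧ (var q)  w = refl
  eval-⟦⟧ ⊤̇        w = refl
  eval-⟦⟧ ⊥̇        w = refl
  eval-⟦⟧ (¬̇ A)    w = cong not (eval-⟦⟧ A w)
  eval-⟦⟧ (A ∧̇ B)  w = cong₂ _∧_ (eval-⟦⟧ A w) (eval-⟦⟧ B w)
  eval-⟦⟧ (A ∨̇ B)  w = cong₂ _∨_ (eval-⟦⟧ A w) (eval-⟦⟧ B w)
  eval-⟦⟧ (A →̇ B)  w = cong₂ (λ x y → not x ∨ y) (eval-⟦⟧ A w) (eval-⟦⟧ B w)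
  eval-⟦⟧ (A ↔̇ B)  w = cong₂ (λ x y → not (x xor y)) (eval-⟦⟧ A w) (eval-⟦⟧ B w)
  eval-⟦⟧ (O A)    w = refl
  eval-⟦⟧ (P A)    w = refl

  O-elim : ∀ A {w u} → T (⟦ O A ⟧ w) → u ∈ cluster → T (⟦ A ⟧ u)
  O-elim A h = All.lookup (all⁺ ⟦ A ⟧ cluster h)

  O-intro : ∀ A {w} → (∀ {u} → u ∈ cluster → T (⟦ A ⟧ u)) → T (⟦ O A ⟧ w)
  O-intro A h = all⁻ ⟦ A ⟧ (All.tabulate h)

  -- The value of `O A` is the same at all worlds, so `w` and `u` may differ; if it were false,
  -- `¬̇ O A` would hold throughout the cluster.
  PO⇒O : ∀ A {w u} → T (⟦ P (O A) ⟧ w) → T (⟦ O A ⟧ u)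
  PO⇒O A {w} h with T? (⟦ O A ⟧ w)
  ... | yes o = o
  ... | no ¬o = contradiction (O-intro (¬̇ O A) {w} (λ _ → from T-not ¬o)) (to T-not h)

  instance-valid : ∀ {σ A} → Instance σ A → ∀ w → T (⟦ A ⟧ w)
  instance-valid (a0 {A} t) w = subst T (eval-⟦⟧ A w) (from T-≡ (t (λ B → ⟦ B ⟧ w)))
  -- Both sides of the biconditional compute to the same Boolean.
  instance-valid (a1 A) w = from T-≡ (cong not (xor-same (⟦ P A ⟧ w)))
  instance-valid (a2 A B) w = from T-⇒ λ h → from T-⇒ λ o →
    O-intro B {w} λ u∈ → to T-⇒ (O-elim (A →̇ B) {w} h u∈) (O-elim A {w} o u∈)
  -- Nonemptiness of the cluster enters here, through its head `c`.
  instance-valid (a3 A) w = from T-⇒ λ o → from T-not λ n →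
    to T-not (O-elim (¬̇ A) {w} n (here refl)) (O-elim A {w} o (here refl))
  instance-valid (a4 A) w = from T-⇒ λ o → O-intro (O A) {w} λ _ → o
  instance-valid (a5 A) w = from T-⇒ λ h → PO⇒O A {w} {w} h
  -- `O A →̇ A` may fail outside the cluster, but the outer `O` asks for it only inside.
  instance-valid (a6 A) w = O-intro (O A →̇ A) {w} λ u∈ → from T-⇒ λ o → O-elim A {w} o u∈
  instance-valid (a7 A) w = O-intro (P (O A) →̇ A) {w} λ u∈ → from T-⇒ λ h →
    O-elim A {w} (PO⇒O A {w} {w} h) u∈

  -- One induction covers all ten systems, since each of A0 to A7 is valid. The claim ranges over
  -- all worlds so that `nec` can use it at those of the cluster.
  sound : ∀ {S A} → S ⊢ A → ∀ w → T (⟦ A ⟧ w)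
  sound (axiom _ i)     w = instance-valid i w
  sound (mp d e)        w = to T-⇒ (sound d w) (sound e w)
  sound (nec {A = A} d) w = O-intro A {w} λ {u} _ → sound d u

module _ where

  open L₁

  names : Formula → List NameVar
  names (ε a b)  = a ∷ b ∷ []
  names (φ ∨̇ ψ)  = names φ ++ names ψ
  names (¬̇ φ)    = names φ

  -- Each premise is moved into the antecedent of the goal and later detached by `mp`; once no
  -- premise is left, the goal is a tautology.
  tautological-consequence : ∀ {Γ φ} → All ⊢_ Γ →
    (∀ v → All (T ∘ eval v) Γ → T (eval v φ)) → ⊢ φ
  tautological-consequence []       h = taut λ v → to T-≡ (h v [])
  tautological-consequence (d ∷ ds) h =
    mp (tautological-consequence ds λ v hs → from T-⇒ λ x → h v (x ∷ hs)) d

  -- Relativised to a list of names because a derivation can invoke only finitely many axiom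
  -- instances.
  record IsModelOn (ns : List NameVar) (v : NameVar → NameVar → Bool) : Set where
    field
      diagonal   : ∀ {a b} → a ∈ ns → b ∈ ns → T (v a b) → T (v a a)
      transitive : ∀ {a b c} → a ∈ ns → b ∈ ns → c ∈ ns →
                   T (v a b) → T (v b c) → T (v a c)
      converse   : ∀ {a b c} → a ∈ ns → b ∈ ns → c ∈ ns →
                   T (v a b) → T (v b c) → T (v b a)

  axiomsAt : NameVar × NameVar × NameVar → List Formula
  axiomsAt (a , b , c) =
      (ε a b ⊃ ε a a)
    ∷ ((ε a b ∧̇ ε b c) ⊃ ε a c)
    ∷ ((ε a b ∧̇ ε b c) ⊃ ε b a)
    ∷ []

  triples : List NameVar → List (NameVar × NameVar × NameVar)
  triples ns = cartesianProduct ns (cartesianProduct ns ns)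

  ⊢axiomsAt : ∀ t → All ⊢_ (axiomsAt t)
  ⊢axiomsAt (a , b , c) = ax1 a b ∷ ax2 a b c ∷ ax3 a b c ∷ []

  eval-∧ : ∀ {v} φ ψ → T (eval v φ) → T (eval v ψ) → T (eval v (φ ∧̇ ψ))
  eval-∧ {v} φ ψ x y with eval v φ | eval v ψ
  ... | true | true = tt

  isModelOn : ∀ {ns v} → All (T ∘ eval v) (concatMap axiomsAt (triples ns)) → IsModelOn ns v
  isModelOn {ns} {v} hs = record
    -- `ax1` concerns two names only, so `b` fills the third slot of the triple.
    { diagonal   = λ a∈ b∈ x → diagonal-at (at a∈ b∈ b∈) x
    ; transitive = λ a∈ b∈ c∈ x y → transitive-at (at a∈ b∈ c∈) x y
    ; converse   = λ a∈ b∈ c∈ x y → converse-at (at a∈ b∈ c∈) x y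
    }
    where
    at : ∀ {a b c} → a ∈ ns → b ∈ ns → c ∈ ns → All (T ∘ eval v) (axiomsAt (a , b , c))
    at a∈ b∈ c∈ = All.lookup (map⁻ (concat⁻ hs))
      (∈-cartesianProduct⁺ a∈ (∈-cartesianProduct⁺ b∈ c∈))

    diagonal-at : ∀ {a b c} → All (T ∘ eval v) (axiomsAt (a , b , c)) → T (v a b) → T (v a a)
    diagonal-at (p ∷ _) = to T-⇒ p

    transitive-at : ∀ {a b c} → All (T ∘ eval v) (axiomsAt (a , b , c)) →
                    T (v a b) → T (v b c) → T (v a c)
    transitive-at {a} {b} {c} (_ ∷ p ∷ _) x y = to T-⇒ p (eval-∧ {v} (ε a b) (ε b c) x y)

    converse-at : ∀ {a b c} → All (T ∘ eval v) (axiomsAt (a , b , c)) →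
                  T (v a b) → T (v b c) → T (v b a)
    converse-at {a} {b} {c} (_ ∷ _ ∷ p ∷ _) x y = to T-⇒ p (eval-∧ {v} (ε a b) (ε b c) x y)

  complete-on-names : ∀ {ns φ} → (∀ v → IsModelOn ns v → T (eval v φ)) → ⊢ φ
  complete-on-names {ns} h = tautological-consequence
    (concat⁺ (map⁺ (All.universal ⊢axiomsAt (triples ns))))
    (λ v hs → h v (isModelOn hs))

-- A world is the set of names a for which p_a holds there.
module Countermodel (p : NameVar → PropVar) (p-injective : Injective _≡_ _≡_ p)
                    (n : NameVar) (ns : List NameVar) (v : NameVar → NameVar → Bool)
                    (model : IsModelOn (n ∷ ns) v) where

  open IsModelOn model

  World : Set
  World = NameVar → Bool

  atom : World → PropVar → NameVar → Bool
  atom w q a = (p a ≡ᵇ q) ∧ w a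

  -- A valuation is indexed by propositional variables, so `p` is inverted by searching the listed
  -- names; injectivity makes the search return the intended value in `V-p`.
  V : PropVar → World → Bool
  V q w = any (atom w q) (n ∷ ns)

  worldOf : NameVar → World
  worldOf c a = v c a

  actual : World
  actual a = v a a

  open ClusterModel (worldOf n) (map worldOf ns) V

  V-p : ∀ {a} w → a ∈ n ∷ ns → T (V (p a) w) ⇔ T (w a)
  V-p {a} w a∈ = mk⇔ forth back
    where
    forth : T (V (p a) w) → T (w a)
    forth h with find (any⁻ (atom w (p a)) (n ∷ ns) h)
    ... | b , _ , hb with to T-∧ hb
    ...   | pb≡pa , wb = subst (T ∘ w) (p-injective (≡ᵇ⇒≡ (p b) (p a) pb≡pa)) wb

    back : T (w a) → T (V (p a) w)
    back wa = any⁺ (atom w (p a)) (lose a∈ (from T-∧ (≡⇒≡ᵇ (p a) (p a) refl , wa)))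

  -- The cluster computes to `map worldOf (n ∷ ns)`, so quantifying over its worlds is quantifying
  -- over listed names.
  O-implies : ∀ {a b w} → a ∈ n ∷ ns → b ∈ n ∷ ns →
    T (⟦ SH.O (SH.var (p a) SH.→̇ SH.var (p b)) ⟧ w) ⇔
    (∀ {c} → c ∈ n ∷ ns → T (v c a) → T (v c b))
  O-implies {a} {b} a∈ b∈ = mk⇔
    (λ h {c} c∈ x → to (V-p (worldOf c) b∈)
      (to T-⇒ (All.lookup (map⁻ {f = worldOf} (all⁺ ⟦ A ⟧ cluster h)) c∈)
        (from (V-p (worldOf c) a∈) x)))
    (λ h → all⁻ ⟦ A ⟧ (map⁺ {f = worldOf} (All.tabulate λ {c} c∈ → from T-⇒ λ x →
      from (V-p (worldOf c) b∈) (h c∈ (to (V-p (worldOf c) a∈) x)))))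
    where
    A = SH.var (p a) SH.→̇ SH.var (p b)

  truth-ε : ∀ {a b} → a ∈ n ∷ ns → b ∈ n ∷ ns →
    T (⟦ Bᴼ p (L₁.ε a b) ⟧ actual) ⇔ T (v a b)
  truth-ε {a} {b} a∈ b∈ = mk⇔ forth back
    where
    forth : T (⟦ Bᴼ p (L₁.ε a b) ⟧ actual) → T (v a b)
    forth h with to T-∧ h
    ... | pa , rest = to (O-implies {w = actual} a∈ b∈) (proj₁ (to T-∧ rest)) a∈
                         (to (V-p actual a∈) pa)

    back : T (v a b) → T (⟦ Bᴼ p (L₁.ε a b) ⟧ actual)
    back ab = from T-∧
      ( from (V-p actual a∈) (diagonal a∈ b∈ ab)
      , from T-∧
        ( from (O-implies {w = actual} a∈ b∈) (λ c∈ ca → transitive c∈ a∈ b∈ ca ab)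
        -- At the actual world `pb` means `v b b`; with `ab`, `converse` at a, b, b yields `v b a`,
        -- and `transitive` then takes `v c b` to `v c a`.
        , from T-⇒ λ pb → from (O-implies {w = actual} b∈ a∈) λ c∈ cb →
            transitive c∈ b∈ a∈ cb (converse a∈ b∈ b∈ ab (to (V-p actual b∈) pb))))

  -- An equality of Booleans, not an implication, so that the induction passes through negation.
  truth : ∀ φ → (∀ {a} → a ∈ names φ → a ∈ n ∷ ns) →
    ⟦ Bᴼ p φ ⟧ actual ≡ L₁.eval v φ
  truth (L₁.ε a b) ⊆ns = T-cong (truth-ε (⊆ns (here refl)) (⊆ns (there (here refl))))
  truth (φ L₁.∨̇ ψ) ⊆ns =
    cong₂ _∨_ (truth φ (⊆ns ∘ ∈-++⁺ˡ)) (truth ψ (⊆ns ∘ ∈-++⁺ʳ (names φ)))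
  truth (L₁.¬̇ φ)   ⊆ns = cong not (truth φ ⊆ns)

  valid⇒true : ∀ {S φ} → (∀ {a} → a ∈ names φ → a ∈ n ∷ ns) →
    S SH.⊢ Bᴼ p φ → T (L₁.eval v φ)
  valid⇒true {φ = φ} ⊆ns d = subst T (truth φ ⊆ns) (sound d actual)

-- The extra name 0 only serves to make the cluster visibly nonempty.
theorem5p3 : (p : NameVar → PropVar) → Injective _≡_ _≡_ p →
    (S : SH.System) (φ : L₁.Formula) → S SH.⊢ Bᴼ p φ → L₁.⊢ φ
theorem5p3 p p-injective S φ d = complete-on-names {0 ∷ names φ} λ v model →
  Countermodel.valid⇒true p p-injective 0 (names φ) v model {φ = φ} there d
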